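{- The axiomatisation of $\mathsf{SPQ}$ is sound: for every formula $\varphi\in\mathcal{L}_{\mathsf{SPQ}}$, if $\vdash_{\mathsf{SPQ}}\varphi$ then $\varphi$ is valid, i.e. $\mathcal{M},w\vDash\varphi$ for every model $\mathcal{M}$ and every state $w$ of $\mathcal{M}$.
   Context: LANGUAGE. $\mathsf{Prop}$ is a countable set of propositional letters and $\mathbb{AG}$ is a finite set of agents. $\mathcal{L}_{PL}$ is the propositional language $A::=p\mid\neg A\mid(A\wedge A)$ with $p\in\mathsf{Prop}$ (other connectives and $\top,\bot$ are the usual abbreviations). $\mathsf{Terms}=\{c_i(A)\mid A\in\mathcal{L}_{PL}, i\in\mathbb{AG}\}\cup\{b_i\mid i\in\mathbb{AG}\}$ is a set of formal terms ($c_i(A)$: cost of $A$ for agent $i$; $b_i$: budget of $i$). The language $\mathcal{L}_{\mathsf{SPQ}}$ is $$\varphi::=p\mid (z_1t_1+\dots+z_nt_n\geq z)\mid\neg\varphi\mid(\varphi\wedge\varphi)\mid K_i\varphi\mid C_G\varphi\mid[?_G^A]\varphi,$$ with $p\in\mathsf{Prop}$, $t_1,\dots,t_n\in\mathsf{Terms}$, $z_1,\dots,z_n,z\in\mathbb{Z}$, $i\in\mathbb{AG}$, $G\subseteq\mathbb{AG}$ ($G\neq\emptyset$ in $[?_G^A]$), $A\in\mathcal{L}_{PL}$. Abbreviations: $E_G\varphi:=\bigwedge_{i\in G}K_i\varphi$. For a linear expression $e=\sum_l z_lt_l$: $e\leq z$ is $\sum_l(-z_l)t_l\geq -z$; $e<z$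 is $\neg(e\geq z)$; $e>z$ is $\neg(e\leq z)$; $e=z$ is $(e\geq z)\wedge(e\leq z)$; $e_1\geq e_2$ is $e_1-e_2\geq 0$ (similarly $\leq,=$); an inequality with rational coefficients stands for the one obtained by multiplying by a positive common denominator. Further $$\mathrm{BCS}(G,A):=\bigvee_{j\in G}\bigwedge_{i\in G}\Bigl(c_j(A)\leq c_i(A)\wedge b_i\geq\tfrac{c_j(A)}{|G|}\Bigr).$$ For $A,B\in\mathcal{L}_{PL}$, $A\approx B$ means that $A\leftrightarrow B$ or $A\leftrightarrow\neg B$ is a propositional tautology. SEMANTICS. A model is $\mathcal{M}=(W,(\sim_i)_{i\in\mathbb{AG}},\mathsf{Cost},\mathsf{Bdg},V)$ with $W\neq\emptyset$; each $\sim_i$ an equivalence relation on $W$; $\mathsf{Cost}:\mathbb{AG}\times W\times\mathcal{L}_{PL}\to\mathbb{Q}_{\geq 0}$ and $\mathsf{Bdg}:\mathbb{AG}\times W\to\mathbb{Q}_{\geq 0}$ (written $\mathsf{Cost}_i(w,A)$, $\mathsf{Bdg}_i(w)$); $V:\mathsf{Prop}\to 2^W$; such that for all $i,w$: (C1) $\mathsf{Cost}_i(w,\top)=0$; (C2) $A\approx B$ implies $\mathsf{Cost}_i(w,A)=\mathsf{Cost}_i(w,B)$. Write $x\sim_G y$ iff there are $k\geq 1$ and $w_0=x,\dots,w_k=y$ in $W$ such that for each $0\leq j\leq k-1$ some $i\in G$ has $w_j\sim_i w_{j+1}$. Truth: $\mathcal{M},w\vDash p$ iff $w\in V(p)$;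 Boolean clauses as usual; $\mathcal{M},w\vDash K_i\varphi$ iff $\mathcal{M},w'\vDash\varphi$ for all $w'$ with $w\sim_iw'$; $\mathcal{M},w\vDash C_G\varphi$ iff $\mathcal{M},w'\vDash\varphi$ for all $w'$ with $w\sim_Gw'$; $\mathcal{M},w\vDash(\sum_l z_lt_l\geq z)$ iff the inequality holds when each $c_i(A)$ is interpreted as $\mathsf{Cost}_i(w,A)$ and each $b_i$ as $\mathsf{Bdg}_i(w)$; $\mathcal{M},w\vDash[?_G^A]\varphi$ iff $\mathcal{M},w\vDash\mathrm{BCS}(G,A)$ implies $\mathcal{M}^{?_G^A},w\vDash\varphi$. The updated model $\mathcal{M}^{?_G^A}=(W',(\sim_j')_j,\mathsf{Cost}',\mathsf{Bdg}',V')$ has: $W'=\{w\in W\mid\mathcal{M},w\vDash\mathrm{BCS}(G,A)\}$; for $j\notin G$, $\sim_j'$ is $\sim_j$ restricted to $W'$; for $j\in G$, $x\sim'_jy$ iff $x,y\in W'$, $x\sim_jy$ and $x,y$ agree on the truth of $A$ in $\mathcal{M}$; $\mathsf{Cost}'$ is the restriction of $\mathsf{Cost}$; $\mathsf{Bdg}'_j(w)=\mathsf{Bdg}_j(w)-\frac{1}{|G|}\min_{i\in G}\mathsf{Cost}_i(w,A)$ if $j\in G$ and $\mathsf{Bdg}'_j(w)=\mathsf{Bdg}_j(w)$ otherwise; $V'(p)=V(p)\cap W'$. PROOF SYSTEM. $\vdash_{\mathsf{SPQ}}\varphi$ means that $\varphi$ is derivable from the following axioms (all instances) and rules. Write $(\sum_l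 a_lt_l\geq z)^{(G,A)}$ for $\bigvee_{j\in G}\bigl(\bigwedge_{k\in G}c_j(A)\leq c_k(A)\ \wedge\ \theta_j\bigr)$, where $\theta_j$ is $\sum_l a_lt_l\geq z$ with every occurrence of $b_i$, $i\in G$, among the $t_l$ replaced by $b_i-\frac{c_j(A)}{|G|}$. Axioms: (Taut) all propositional tautologies; (I1) $(\sum_{i=1}^k a_it_i\geq c)\leftrightarrow(\sum_{i=1}^k a_it_i+0t_{k+1}\geq c)$; (I2) $(\sum_{i=1}^k a_it_i\geq c)\to(\sum_{i=1}^k a_{j_i}t_{j_i}\geq c)$ for $j_1,\dots,j_k$ a permutation of $1,\dots,k$; (I3) $(\sum_{i=1}^k a_it_i\geq c)\wedge(\sum_{i=1}^k a_i't_i\geq c')\to\sum_{i=1}^k(a_i+a_i')t_i\geq c+c'$; (I4) $(\sum_{i=1}^k a_it_i\geq c)\leftrightarrow(\sum_{i=1}^k da_it_i\geq dc)$ for $d>0$; (I5) $(t\geq c)\vee(t\leq c)$; (I6) $(t\geq c)\to(t>d)$ for $c>d$ (in (I5), (I6) $t$ is any linear expression $\sum_l a_lt_l$); (K) $K_i(\varphi\to\psi)\to(K_i\varphi\to K_i\psi)$; (T) $K_i\varphi\to\varphi$; (4) $K_i\varphi\to K_iK_i\varphi$; (5) $\neg K_i\varphi\to K_i\neg K_i\varphi$; (C) $C_G\varphi\to E_G(\varphi\wedge C_G\varphi)$; (B$^+$) $b_i\geq 0$; (c$^+$) $c_i(A)\geq 0$; (c$^\top$) $c_i(\top)=0$;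 (c$^\approx$) $c_i(A)=c_i(B)$ if $A\approx B$; (r$_p$) $[?_G^A]p\leftrightarrow(\mathrm{BCS}(G,A)\to p)$; (r$_\geq$) $[?_G^A](\sum_l a_lt_l\geq z)\leftrightarrow(\mathrm{BCS}(G,A)\to(\sum_l a_lt_l\geq z)^{(G,A)})$; (r$_\neg$) $[?_G^A]\neg\varphi\leftrightarrow(\mathrm{BCS}(G,A)\to\neg[?_G^A]\varphi)$; (r$_\wedge$) $[?_G^A](\varphi\wedge\psi)\leftrightarrow[?_G^A]\varphi\wedge[?_G^A]\psi$; (r$_{K1}$) $[?_G^A]K_j\varphi\leftrightarrow(\mathrm{BCS}(G,A)\to K_j[?_G^A]\varphi)$ for $j\notin G$; (r$_{K2}$) $[?_G^A]K_i\varphi\leftrightarrow\bigl(\mathrm{BCS}(G,A)\to\bigwedge_{A'\in\{A,\neg A\}}(A'\to K_i(A'\to[?_G^A]\varphi))\bigr)$ for $i\in G$. Rules: (MP) from $\varphi$ and $\varphi\to\psi$ infer $\psi$; (Nec$_i$) from $\varphi$ infer $K_i\varphi$; (RC1) from $\varphi\to E_G(\varphi\wedge\psi)$ infer $\varphi\to C_G\psi$; (Rep) from $\varphi\leftrightarrow\psi$ infer $[?_G^A]\varphi\leftrightarrow[?_G^A]\psi$; (RC2) from $\chi\to[?_G^A]\psi$ and $(\chi\wedge\mathrm{BCS}(G,A))\to\bigl(\bigwedge_{A'\in\{A,\neg A\}}(A'\to E_{H\cap G}(A'\to\chi))\wedge E_{H\setminus G}\chi\bigr)$ infer $\chi\to[?_G^A]C_H\psi$.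 -}

module Defs where

open import Data.Bool.Base as Bool using (Bool; true; false; T; not; if_then_else_)
open import Data.Bool.Properties using (T-∧)
open import Data.Empty using (⊥-elim-irr)
open import Data.Fin.Base using (Fin; suc)
open import Data.Fin.Subset using (Subset; _∈_; _∉_; _∩_; _─_; ∣_∣; Nonempty)
open import Data.Fin.Subset.Properties using (_∈?_; ∉⊥)
open import Data.Integer.Base as ℤ using (ℤ; +_; -[1+_])
open import Data.List.Base as List using (List; []; _∷_; allFin; filter; foldr)
open import Data.List.Membership.Propositional as List∈ using ()
open import Data.List.Membership.Propositional.Properties using (∈-filter⁺; ∈-map⁺; ∈-allFin)
open import Data.List.NonEmpty.Base as List⁺ using (List⁺; _∷_; toList; _⁺++⁺_; _⁺∷ʳ_)
open import Data.List.Relation.Binary.Permutation.Propositional using (_↭_)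
open import Data.List.Relation.Unary.Any as Any using (here; there)
open import Data.Nat.Base as ℕ using (ℕ)
open import Data.Vec.Base using ([]; _∷_; there)
open import Data.Product.Base using (Σ-syntax; ∃-syntax; _×_; _,_; proj₁; proj₂)
open import Data.Rational.Base as ℚ using (ℚ; 0ℚ; 1ℚ; _/_; toℚᵘ)
open import Data.Rational.Properties as ℚₚ using (_≤?_; ≤-decTotalOrder)
import Data.Integer.Properties as ℤₚ
import Data.Rational.Unnormalised.Base as ℚᵘ
import Data.Rational.Unnormalised.Properties as ℚᵘₚ
open import Data.Irrelevant using ([_])
open import Data.Refinement.Base using (Refinement-syntax; value; _,_)
open import Data.Sum.Base using (_⊎_; inj₁; inj₂)
open import Function.Base using (_∘_)
open import Function.Bundles using (mk⇔; Equivalence) renaming (_⇔_ to _⇔′_)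
open Equivalence using (to; from)
open import Relation.Binary.Bundles using (DecTotalOrder)
open import Relation.Binary.Construct.Closure.Transitive using (TransClosure)
open import Relation.Binary.PropositionalEquality
  using (_≡_; refl; sym; trans; cong; subst)
open import Relation.Binary.Structures using (IsEquivalence)
open import Relation.Nullary using (¬_; yes; no; does; contradiction)
open import Relation.Nullary.Decidable using (isYes; toWitness; fromWitness)

open import Data.List.Extrema (DecTotalOrder.totalOrder ≤-decTotalOrder) using (min; min≤v⁺)

size-nonZero : ∀ {n} (G : Subset n) → .(Nonempty G) → ℕ.NonZero ∣ G ∣
size-nonZero []           ne = ⊥-elim-irr (∉⊥ (proj₂ ne))
size-nonZero (true  ∷ G)  ne = _
size-nonZero (false ∷ G)  ne = size-nonZero G (drop ne)
  where
  drop : Nonempty (false ∷ G) → Nonempty G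
  drop (suc i , there i∈G) = i , i∈G

private
  inverse : ∀ k .{{_ : ℕ.NonZero k}} → (+ 1 / k) ℚ.* (+ k / 1) ≡ 1ℚ
  inverse k@(ℕ.suc k-1) = ℚₚ.toℚᵘ-injective (begin-equality
    toℚᵘ ((+ 1 / k) ℚ.* (+ k / 1))          ≃⟨ ℚₚ.toℚᵘ-homo-* (+ 1 / k) (+ k / 1) ⟩
    toℚᵘ (+ 1 / k) ℚᵘ.* toℚᵘ (+ k / 1)      ≃⟨ ℚᵘₚ.*-cong (ℚₚ.toℚᵘ-fromℚᵘ (ℚᵘ.mkℚᵘ (+ 1) k-1))
                                                          (ℚₚ.toℚᵘ-fromℚᵘ (ℚᵘ.mkℚᵘ (+ k) 0)) ⟩
    ℚᵘ.mkℚᵘ (+ 1) k-1 ℚᵘ.* ℚᵘ.mkℚᵘ (+ k) 0  ≃⟨ ℚᵘ.*≡* (ℤₚ.*-assoc (+ 1) (+ k) (+ 1)) ⟩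
    ℚᵘ.1ℚᵘ                                  ∎)
    where open ℚᵘₚ.≤-Reasoning

  affordable : ∀ k .{{_ : ℕ.NonZero k}} (m c b : ℚ) → m ℚ.≤ c →
               + 0 / 1 ℚ.≤ (+ k / 1) ℚ.* b ℚ.+ ((-[1+ 0 ] / 1) ℚ.* c ℚ.+ 0ℚ) →
               0ℚ ℚ.≤ b ℚ.- (+ 1 / k) ℚ.* m
  affordable k m c b m≤c h = begin
    0ℚ                     ≡⟨ ℚₚ.+-inverseʳ (q ℚ.* m) ⟨
    q ℚ.* m ℚ.- q ℚ.* m    ≤⟨ ℚₚ.+-monoˡ-≤ (ℚ.- (q ℚ.* m)) qm≤b ⟩
    b ℚ.- q ℚ.* m          ∎
    where
    open ℚₚ.≤-Reasoning
    q = + 1 / k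
    z = + k / 1
    -c = (-[1+ 0 ] / 1) ℚ.* c ℚ.+ 0ℚ
    instance
      q≥0 : ℚ.NonNegative q
      q≥0 = ℚₚ.normalize-nonNeg 1 k

    -c+c≡0 : -c ℚ.+ c ≡ 0ℚ
    -c+c≡0 = begin-equality
      -c ℚ.+ c                  ≡⟨ cong (ℚ._+ c) (ℚₚ.+-identityʳ (ℚ.- 1ℚ ℚ.* c)) ⟩
      ℚ.- 1ℚ ℚ.* c ℚ.+ c        ≡⟨ cong (ℚ._+ c) (ℚₚ.neg-distribˡ-* 1ℚ c) ⟨
      ℚ.- (1ℚ ℚ.* c) ℚ.+ c      ≡⟨ cong (λ x → ℚ.- x ℚ.+ c) (ℚₚ.*-identityˡ c) ⟩
      ℚ.- c ℚ.+ c               ≡⟨ ℚₚ.+-inverseˡ c ⟩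
      0ℚ                        ∎

    c≤zb : c ℚ.≤ z ℚ.* b
    c≤zb = begin
      c                      ≡⟨ ℚₚ.+-identityˡ c ⟨
      0ℚ ℚ.+ c               ≤⟨ ℚₚ.+-monoˡ-≤ c h ⟩
      z ℚ.* b ℚ.+ -c ℚ.+ c   ≡⟨ ℚₚ.+-assoc (z ℚ.* b) -c c ⟩
      z ℚ.* b ℚ.+ (-c ℚ.+ c) ≡⟨ cong (z ℚ.* b ℚ.+_) -c+c≡0 ⟩
      z ℚ.* b ℚ.+ 0ℚ         ≡⟨ ℚₚ.+-identityʳ (z ℚ.* b) ⟩
      z ℚ.* b                ∎

    qz≡1 : q ℚ.* z ≡ 1ℚ
    qz≡1 = inverse k

    qm≤b : q ℚ.* m ℚ.≤ b
    qm≤b = begin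
      q ℚ.* m          ≤⟨ ℚₚ.*-monoˡ-≤-nonNeg q m≤c ⟩
      q ℚ.* c          ≤⟨ ℚₚ.*-monoˡ-≤-nonNeg q c≤zb ⟩
      q ℚ.* (z ℚ.* b)  ≡⟨ ℚₚ.*-assoc q z b ⟨
      q ℚ.* z ℚ.* b    ≡⟨ cong (ℚ._* b) qz≡1 ⟩
      1ℚ ℚ.* b         ≡⟨ ℚₚ.*-identityˡ b ⟩
      b                ∎

------------------------------------------------------------------------
-- Boolean combinations of atoms.  Used with three kinds of atoms: the
-- letters (propositional language), ℕ (schemata for tautologies), and
-- letters or inequalities (update-free, modality-free formulas).

data BoolForm (X : Set) : Set where
  atom : X → BoolForm X
  neg  : BoolForm X → BoolForm X
  conj : BoolForm X → BoolForm X → BoolForm X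

eval : {X : Set} → (X → Bool) → BoolForm X → Bool
eval v (atom x)   = v x
eval v (neg B)    = not (eval v B)
eval v (conj B D) = eval v B Bool.∧ eval v D

Tautology : {X : Set} → BoolForm X → Set
Tautology {X} B = (v : X → Bool) → T (eval v B)

-- `Letter` is the set of propositional letters and `Fin n` the set of
-- agents.  The letter p₀ serves to write ⊤ as the abbreviation p₀ ∨ ¬ p₀.

module SPQ (Letter : Set) (p₀ : Letter) (n : ℕ) where

  Agent : Set
  Agent = Fin n

  Group : Set
  Group = [ G ∈ Subset n ∣ Nonempty G ]

  members : Subset n → List Agent
  members G = filter (_∈? G) (allFin n)

  record Language (F : Set) : Set where
    infix  8 ~_
    infixr 7 _∧_
    infixr 6 _∨_
    infixr 5 _⇒_
    infix  4 _⇔_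
    field
      letter : Letter → F
      ~_     : F → F
      _∧_    : F → F → F

    _∨_ _⇒_ _⇔_ : F → F → F
    φ ∨ ψ = ~ (~ φ ∧ ~ ψ)
    φ ⇒ ψ = ~ (φ ∧ ~ ψ)
    φ ⇔ ψ = (φ ⇒ ψ) ∧ (ψ ⇒ φ)

    ⊤ ⊥ : F
    ⊤ = letter p₀ ∨ ~ letter p₀
    ⊥ = ~ ⊤

    ⋀ ⋁ : {I : Set} → List I → (I → F) → F
    ⋀ is φ = foldr (λ i → φ i ∧_) ⊤ is
    ⋁ is φ = foldr (λ i → φ i ∨_) ⊥ is

  open Language ⦃...⦄ public

  PL : Set
  PL = BoolForm Letter

  instance
    PL-language : Language PL
    PL-language = record { letter = atom ; ~_ = neg ; _∧_ = conj }

  infix 4 _≈_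
  _≈_ : PL → PL → Set
  A ≈ B = Tautology (A ⇔ B) ⊎ Tautology (A ⇔ ~ B)

  data Term : Set where
    cost   : Agent → PL → Term
    budget : Agent → Term

  LinExp : Set
  LinExp = List⁺ (ℤ × Term)

  data Atom : Set where
    var : Letter → Atom
    ineq : LinExp → ℤ → Atom      -- z₁t₁ + … + zₖtₖ ≥ z

  data Form : Set where
    atom    : Atom → Form
    neg     : Form → Form
    conj    : Form → Form → Form
    K       : Agent → Form → Form
    C       : Subset n → Form → Form
    [?_^_]_ : Group → PL → Form → Form

  infix 8 [?_^_]_

  -- BCS(G,A) is not a subformula of [?_G^A]φ, so for truth to be defined by
  -- recursion on formulas it lives in this fragment, which is embedded in
  -- `Form` by ⌈_⌉ and has its own Boolean evaluation; see ⊨⌈⌉ below.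
  Static : Set
  Static = BoolForm Atom

  instance
    Static-language : Language Static
    Static-language = record { letter = λ p → atom (var p) ; ~_ = neg ; _∧_ = conj }

    Form-language : Language Form
    Form-language = record { letter = λ p → atom (var p) ; ~_ = neg ; _∧_ = conj }

  inst : {X : Set} → (X → Form) → BoolForm X → Form
  inst σ (atom x)   = σ x
  inst σ (neg B)    = neg (inst σ B)
  inst σ (conj B D) = conj (inst σ B) (inst σ D)

  pl : PL → Form
  pl = inst letter

  ⌈_⌉ : Static → Form
  ⌈_⌉ = inst atom

  E : Subset n → Form → Form
  E G φ = ⋀ (members G) (λ i → K i φ)

  infix  7.8 _·_
  infixl 7.6 _⊝_
  infix  7.4 _≥ᶜ_ _≤ᶜ_ _>ᶜ_ _=ᶜ_ _≥ᵉ_ _≤ᵉ_ _=ᵉ_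

  _·_ : ℤ → Term → LinExp
  z · t = (z , t) ∷ []

  scale : ℤ → LinExp → LinExp
  scale d = List⁺.map (λ (a , t) → d ℤ.* a , t)

  _⊝_ : LinExp → LinExp → LinExp
  e ⊝ f = e ⁺++⁺ List⁺.map (λ (a , t) → ℤ.- a , t) f

  _≥ᶜ_ _≤ᶜ_ _>ᶜ_ _=ᶜ_ : LinExp → ℤ → Static
  e ≥ᶜ z = atom (ineq e z)
  e ≤ᶜ z = List⁺.map (λ (a , t) → ℤ.- a , t) e ≥ᶜ (ℤ.- z)
  e >ᶜ z = ~ (e ≤ᶜ z)
  e =ᶜ z = (e ≥ᶜ z) ∧ (e ≤ᶜ z)

  _≥ᵉ_ _≤ᵉ_ _=ᵉ_ : LinExp → LinExp → Static
  e ≥ᵉ f = e ⊝ f ≥ᶜ + 0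
  e ≤ᵉ f = e ⊝ f ≤ᶜ + 0
  e =ᵉ f = e ⊝ f =ᶜ + 0

  cheapest : Subset n → PL → Agent → Static
  cheapest G A j = ⋀ (members G) (λ i → + 1 · cost j A ≤ᵉ + 1 · cost i A)

  -- The inequality bᵢ ≥ c_j(A)/|G| is written with both sides multiplied
  -- by |G|.
  BCS : Subset n → PL → Static
  BCS G A = ⋁ (members G) λ j → ⋀ (members G) λ i →
    (+ 1 · cost j A ≤ᵉ + 1 · cost i A) ∧ (+ ∣ G ∣ · budget i ≥ᵉ + 1 · cost j A)

  -- |G| times the result of replacing each bᵢ (i ∈ G) by bᵢ − c_j(A)/|G|.
  chargeTerm : Subset n → PL → Agent → ℤ × Term → LinExp
  chargeTerm G A j (a , cost i B) = (+ ∣ G ∣ ℤ.* a) · cost i B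
  chargeTerm G A j (a , budget i) =
    if does (i ∈? G)
    then (+ ∣ G ∣ ℤ.* a , budget i) ∷ (ℤ.- a , cost j A) ∷ []
    else (+ ∣ G ∣ ℤ.* a) · budget i

  charge : Subset n → PL → Agent → LinExp → LinExp
  charge G A j = List⁺.concatMap (chargeTerm G A j)

  -- (e ≥ z)^(G,A), each θ_j being multiplied by |G|.
  _≥ᶜ_^⟨_,_⟩ : LinExp → ℤ → Subset n → PL → Static
  e ≥ᶜ z ^⟨ G , A ⟩ = ⋁ (members G) λ j →
    cheapest G A j ∧ (charge G A j e ≥ᶜ (+ ∣ G ∣ ℤ.* z))

  record Model : Set₁ where
    field
      W        : Set
      .inhabitant : W
      _∼[_]_   : W → Agent → W → Set
      ∼-equiv  : ∀ i → IsEquivalence (λ x y → x ∼[ i ] y)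
      Cost     : Agent → W → PL → ℚ
      Bdg      : Agent → W → ℚ
      V        : Letter → W → Bool
      Cost-nonneg : ∀ i w A → 0ℚ ℚ.≤ Cost i w A
      Bdg-nonneg  : ∀ i w → 0ℚ ℚ.≤ Bdg i w
      Cost-⊤   : ∀ i w → Cost i w ⊤ ≡ 0ℚ
      Cost-≈   : ∀ i w {A B} → A ≈ B → Cost i w A ≡ Cost i w B

    ⟦_⟧ᵗ : Term → W → ℚ
    ⟦ cost i A ⟧ᵗ w = Cost i w A
    ⟦ budget i ⟧ᵗ w = Bdg i w

    ⟦_⟧ᵉ : LinExp → W → ℚ
    ⟦ e ⟧ᵉ w = foldr (λ (a , t) q → (a / 1) ℚ.* ⟦ t ⟧ᵗ w ℚ.+ q) 0ℚ (toList e)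

    truth : W → Atom → Bool
    truth w (var p)    = V p w
    truth w (ineq e z) = isYes (z / 1 ≤? ⟦ e ⟧ᵉ w)

    holdsPL : W → PL → Bool
    holdsPL w = eval (λ p → V p w)

    holds : W → Static → Bool
    holds w = eval (truth w)

    _∼⟨_⟩_ : W → Subset n → W → Set
    x ∼⟨ G ⟩ y = TransClosure (λ u v → ∃[ i ] i ∈ G × u ∼[ i ] v) x y

    -- Only ever used with nonempty lists; the first clause is a dummy.
    minCost : W → PL → List Agent → ℚ
    minCost w A []       = 0ℚ
    minCost w A (i ∷ is) = min (Cost i w A) (List.map (λ k → Cost k w A) is)

    -- minᵢ∈G Costᵢ(w,A) / |G|
    share : Group → PL → W → ℚ
    share (G , [ ne ]) A w = (+ 1 / ∣ G ∣) ℚ.* minCost w A (members G)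
      where instance
        _ : ℕ.NonZero ∣ G ∣
        _ = size-nonZero G ne

  module _ (M : Model) where
    open Model M

    ⋁⁻ : ∀ {I : Set} w (is : List I) (φ : I → Static) →
         T (holds w (⋁ is φ)) → ∃[ i ] i List∈.∈ is × T (holds w (φ i))
    ⋁⁻ w [] φ h with V p₀ w
    ... | true  = contradiction h λ ()
    ... | false = contradiction h λ ()
    ⋁⁻ w (i ∷ is) φ h with holds w (φ i) in eq
    ... | true  = i , here refl , subst T (sym eq) _
    ... | false with holds w (⋁ is φ) in eq′
    ...   | true = let j , j∈ , hj = ⋁⁻ w is φ (subst T (sym eq′) _)
                   in j , there j∈ , hj

    ⋀⁻ : ∀ {I : Set} w (is : List I) (φ : I → Static) →
         T (holds w (⋀ is φ)) → ∀ {i} → i List∈.∈ is → T (holds w (φ i))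
    ⋀⁻ w (i ∷ is) φ h (here refl) = proj₁ (to T-∧ h)
    ⋀⁻ w (i ∷ is) φ h (there i∈)  = ⋀⁻ w is φ (proj₂ (to (T-∧ {holds w (φ i)}) h)) i∈

    minCost≤ : ∀ w A is {j} → j List∈.∈ is → minCost w A is ℚ.≤ Cost j w A
    minCost≤ w A (i ∷ is) (here refl) =
      min≤v⁺ (Cost i w A) (List.map (λ k → Cost k w A) is) (inj₁ ℚₚ.≤-refl)
    minCost≤ w A (i ∷ is) (there j∈) =
      min≤v⁺ (Cost i w A) (List.map (λ k → Cost k w A) is) (inj₂ (Any.map (ℚₚ.≤-reflexive ∘ sym) (∈-map⁺ _ j∈)))

    share≤Bdg : ∀ G A w → T (holds w (BCS (value G) A)) →
                ∀ {i} → i ∈ value G → 0ℚ ℚ.≤ Bdg i w ℚ.- share G A w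
    share≤Bdg (G , [ ne ]) A w h {i} i∈G =
      let j , j∈ , hj = ⋁⁻ w (members G) _ h
          hji = ⋀⁻ w (members G) _ hj (∈-filter⁺ (_∈? G) (∈-allFin i) i∈G)
          _ , hb = to (T-∧ {holds w (+ 1 · cost j A ≤ᵉ + 1 · cost i A)}) hji
      in affordable ∣ G ∣ {{size-nonZero G ne}} _ _ _ (minCost≤ w A (members G) j∈)
           (toWitness hb)

    module _ (G : Group) (A : PL) where

      W′ : Set
      W′ = Σ[ w ∈ W ] T (holds w (BCS (value G) A))

      Bdg′ : Agent → W′ → ℚ
      Bdg′ j (w , _) = if does (j ∈? value G) then Bdg j w ℚ.- share G A w else Bdg j w

      Bdg′-nonneg : ∀ j w → 0ℚ ℚ.≤ Bdg′ j w
      Bdg′-nonneg j (w , h) with j ∈? value G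
      ... | yes j∈G = share≤Bdg G A w h j∈G
      ... | no  _   = Bdg-nonneg j w

      -- The irrelevant argument only witnesses nonemptiness of the
      -- updated domain, so the result does not depend on it.
      update : .W′ → Model
      update x = record
        { W           = W′
        ; inhabitant  = x
        ; _∼[_]_      = λ (x , _) j (y , _) →
            x ∼[ j ] y × (j ∈ value G → holdsPL x A ≡ holdsPL y A)
        ; ∼-equiv     = λ j → let module ≈ = IsEquivalence (∼-equiv j) in record
            { refl  = ≈.refl , λ _ → refl
            ; sym   = λ (r , a) → ≈.sym r , λ j∈ → sym (a j∈)
            ; trans = λ (r , a) (s , b) → ≈.trans r s , λ j∈ → trans (a j∈) (b j∈)
            }
        ; Cost        = λ i (w , _) → Cost i w
        ; Bdg         = Bdg′
        ; V           = λ p (w , _) → V p w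
        ; Cost-nonneg = λ i (w , _) → Cost-nonneg i w
        ; Bdg-nonneg  = Bdg′-nonneg
        ; Cost-⊤      = λ i (w , _) → Cost-⊤ i w
        ; Cost-≈      = λ i (w , _) → Cost-≈ i w
        }

  -- All clauses are built from decidable atoms by ¬, × and ∀, so that truth
  -- is stable under double negation and ∨, ⇒ have their classical meaning.
  infix 3 _,_⊨_
  _,_⊨_ : (M : Model) → Model.W M → Form → Set
  M , w ⊨ atom (var p)    = T (Model.V M p w)
  M , w ⊨ atom (ineq e z) = z / 1 ℚ.≤ Model.⟦_⟧ᵉ M e w
  M , w ⊨ neg φ           = ¬ (M , w ⊨ φ)
  M , w ⊨ conj φ ψ        = (M , w ⊨ φ) × (M , w ⊨ ψ)
  M , w ⊨ K i φ           = ∀ w′ → Model._∼[_]_ M w i w′ → M , w′ ⊨ φ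
  M , w ⊨ C G φ           = ∀ w′ → Model._∼⟨_⟩_ M w G w′ → M , w′ ⊨ φ
  M , w ⊨ [? G ^ A ] φ    =
    (h : T (Model.holds M w (BCS (value G) A))) → update M G A (w , h) , (w , h) ⊨ φ

  -- `holds` and `holdsPL`, through which updates are defined, agree with
  -- truth of the corresponding formulas.
  ⊨-inst : ∀ M w {X : Set} (σ : X → Form) (v : X → Bool) →
           (∀ x → (M , w ⊨ σ x) ⇔′ T (v x)) →
           ∀ B → (M , w ⊨ inst σ B) ⇔′ T (eval v B)
  ⊨-inst M w σ v at (atom x)   = at x
  ⊨-inst M w σ v at (neg B)    with eval v B | ⊨-inst M w σ v at B
  ... | true  | ih = mk⇔ (λ ¬b → ¬b (from ih _)) (λ ())
  ... | false | ih = mk⇔ _ (λ _ b → to ih b)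
  ⊨-inst M w σ v at (conj B D) =
    let b = ⊨-inst M w σ v at B ; d = ⊨-inst M w σ v at D in
    mk⇔ (λ (x , y) → from T-∧ (to b x , to d y))
        (λ t → let x , y = to (T-∧ {eval v B}) t in from b x , from d y)

  ⊨⌈⌉ : ∀ M w B → (M , w ⊨ ⌈ B ⌉) ⇔′ T (Model.holds M w B)
  ⊨⌈⌉ M w = ⊨-inst M w atom (Model.truth M w) λ where
    (var p)    → mk⇔ (λ t → t) (λ t → t)
    (ineq e z) → mk⇔ fromWitness toWitness

  ⊨pl : ∀ M w A → (M , w ⊨ pl A) ⇔′ T (Model.holdsPL M w A)
  ⊨pl M w = ⊨-inst M w letter _ λ p → mk⇔ (λ t → t) (λ t → t)

  -- ⋀_{A′ ∈ {A, ¬A}} φ(A′)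
  both : PL → (Form → Form) → Form
  both A φ = φ (pl A) ∧ φ (pl (~ A))

  infix 3 ⊢_
  data ⊢_ : Form → Set where
    Taut : (B : BoolForm ℕ) → Tautology B → (σ : ℕ → Form) → ⊢ inst σ B

    I1 : ∀ {e t c} → ⊢ ⌈ e ≥ᶜ c ⇔ (e ⁺∷ʳ (+ 0 , t)) ≥ᶜ c ⌉
    I2 : ∀ {e e′ c} → toList e ↭ toList e′ → ⊢ ⌈ e ≥ᶜ c ⇒ e′ ≥ᶜ c ⌉
    I3 : ∀ (l : List⁺ (ℤ × ℤ × Term)) {c c′} →
         ⊢ ⌈   List⁺.map (λ (a , a′ , t) → a , t) l ≥ᶜ c
             ∧ List⁺.map (λ (a , a′ , t) → a′ , t) l ≥ᶜ c′
             ⇒ List⁺.map (λ (a , a′ , t) → a ℤ.+ a′ , t) l ≥ᶜ (c ℤ.+ c′) ⌉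
    I4 : ∀ {e c d} → d ℤ.> + 0 → ⊢ ⌈ e ≥ᶜ c ⇔ scale d e ≥ᶜ (d ℤ.* c) ⌉
    I5 : ∀ {e c} → ⊢ ⌈ e ≥ᶜ c ∨ e ≤ᶜ c ⌉
    I6 : ∀ {e c d} → c ℤ.> d → ⊢ ⌈ e ≥ᶜ c ⇒ e >ᶜ d ⌉

    axK : ∀ {i φ ψ} → ⊢ K i (φ ⇒ ψ) ⇒ (K i φ ⇒ K i ψ)
    axT : ∀ {i φ} → ⊢ K i φ ⇒ φ
    ax4 : ∀ {i φ} → ⊢ K i φ ⇒ K i (K i φ)
    ax5 : ∀ {i φ} → ⊢ ~ K i φ ⇒ K i (~ K i φ)
    axC : ∀ {G φ} → ⊢ C G φ ⇒ E G (φ ∧ C G φ)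

    B⁺ : ∀ {i} → ⊢ ⌈ + 1 · budget i ≥ᶜ + 0 ⌉
    c⁺ : ∀ {i A} → ⊢ ⌈ + 1 · cost i A ≥ᶜ + 0 ⌉
    c⊤ : ∀ {i} → ⊢ ⌈ + 1 · cost i ⊤ =ᶜ + 0 ⌉
    c≈ : ∀ {i A B} → A ≈ B → ⊢ ⌈ + 1 · cost i A =ᵉ + 1 · cost i B ⌉

    rp : ∀ {G A p} →
         ⊢ [? G ^ A ] letter p ⇔ (⌈ BCS (value G) A ⌉ ⇒ letter p)
    r≥ : ∀ {G A e z} →
         ⊢ [? G ^ A ] ⌈ e ≥ᶜ z ⌉ ⇔ (⌈ BCS (value G) A ⌉ ⇒ ⌈ e ≥ᶜ z ^⟨ value G , A ⟩ ⌉)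
    r¬ : ∀ {G A φ} →
         ⊢ [? G ^ A ] (~ φ) ⇔ (⌈ BCS (value G) A ⌉ ⇒ ~ [? G ^ A ] φ)
    r∧ : ∀ {G A φ ψ} →
         ⊢ [? G ^ A ] (φ ∧ ψ) ⇔ [? G ^ A ] φ ∧ [? G ^ A ] ψ
    rK₁ : ∀ {G A j φ} → j ∉ value G →
          ⊢ [? G ^ A ] K j φ ⇔ (⌈ BCS (value G) A ⌉ ⇒ K j ([? G ^ A ] φ))
    rK₂ : ∀ {G A i φ} → i ∈ value G →
          ⊢ [? G ^ A ] K i φ ⇔
            (⌈ BCS (value G) A ⌉ ⇒ both A (λ A′ → A′ ⇒ K i (A′ ⇒ [? G ^ A ] φ)))

    MP  : ∀ {φ ψ} → ⊢ φ → ⊢ φ ⇒ ψ → ⊢ ψ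
    Nec : ∀ {i φ} → ⊢ φ → ⊢ K i φ
    RC1 : ∀ {G φ ψ} → ⊢ φ ⇒ E G (φ ∧ ψ) → ⊢ φ ⇒ C G ψ
    Rep : ∀ {G A φ ψ} → ⊢ φ ⇔ ψ → ⊢ [? G ^ A ] φ ⇔ [? G ^ A ] ψ
    RC2 : ∀ {G A H χ ψ} →
          ⊢ χ ⇒ [? G ^ A ] ψ →
          ⊢ χ ∧ ⌈ BCS (value G) A ⌉ ⇒
              both A (λ A′ → A′ ⇒ E (H ∩ value G) (A′ ⇒ χ)) ∧ E (H ─ value G) χ →
          ⊢ χ ⇒ [? G ^ A ] C H ψ

{-# OPTIONS --safe #-}
module Submission where

-- Induction on derivations, for all models at once.  Truth is stable under
-- double negation, which gives ∨ and ⇒ their classical meaning although truth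
-- is not decidable.  For (r≥), wherever BCS(G,A) holds every cheapest j ∈ G has
-- c_j(A) = minᵢ c_i(A), so that charging c_j(A)/|G| evaluates an inequality as
-- the updated model does.  For (RC1) and (RC2), φ resp. χ is an invariant along
-- every path of the original resp. updated model: by (RC2)'s second premise χ is
-- inherited along ∼ᵢ between worlds agreeing on A if i ∈ G, and along all of ∼ᵢ
-- otherwise.

open import Defs
open import Data.Bool.Base using (Bool; true; false; T; not)
open import Data.Bool.Properties using (T-≡; T-∧; T-irrelevant; not-injective)
open import Data.Fin.Subset using (_∈_; _∩_; _─_; ∣_∣)
open import Data.Fin.Subset.Properties using (_∈?_; x∈p∩q⁺; x∈p∧x∉q⇒x∈p─q)
open import Data.Integer.Base as ℤ using (ℤ; +_; -[1+_]; +[1+_])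
import Data.Integer.Properties as ℤₚ
open import Data.Irrelevant using ([_])
open import Data.List.Base using (List; []; _∷_; _++_; allFin; concat; foldr; map)
open import Data.List.Membership.Propositional using () renaming (_∈_ to _∈ₗ_)
open import Data.List.Membership.Propositional.Properties using (∈-filter⁺; ∈-filter⁻; ∈-allFin)
open import Data.List.NonEmpty.Base as List⁺ using (List⁺; toList)
open import Data.List.Relation.Binary.Permutation.Propositional as ↭ using (_↭_)
open import Data.List.Relation.Unary.All as All using ()
import Data.List.Relation.Unary.All.Properties as All
open import Data.List.Relation.Unary.Any using (here; there)
open import Data.Nat.Base as ℕ using (ℕ; zero; suc; s≤s)
import Data.Nat.Properties as ℕₚ
open import Data.Product.Base using (Σ-syntax; ∃-syntax; _×_; _,_; proj₁; proj₂)
open import Data.Rational.Base as ℚ using (ℚ; 0ℚ; 1ℚ; _/_; toℚᵘ; fromℚᵘ; _+_; _*_; _-_; -_; _≤_; _<_)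
import Data.Rational.Properties as ℚₚ
open import Data.Rational.Solver using (module +-*-Solver)
open +-*-Solver using (solve; _:=_; _:+_; _:*_; _:-_; :-_; con)
import Data.Rational.Unnormalised.Base as ℚᵘ
import Data.Rational.Unnormalised.Properties as ℚᵘₚ
open import Data.Refinement.Base using (value; _,_)
open import Data.Sum.Base using (inj₁; inj₂)
open import Function.Base using (_∘_)
open import Function.Bundles using (_↣_; _⇔_; mk⇔; Equivalence)
open Equivalence using (to; from)
open import Relation.Binary.Bundles using (DecTotalOrder)
open import Relation.Binary.Construct.Closure.Transitive using ([_]; _∷_)
open import Relation.Binary.PropositionalEquality
  using (_≡_; refl; sym; trans; cong; cong₂; subst; subst₂; module ≡-Reasoning)
open import Relation.Binary.Structures using (IsEquivalence)
open import Relation.Nullary using (¬_; yes; no; contradiction)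
open import Relation.Nullary.Decidable
  using (isYes; toWitness; fromWitness; decidable-stable; ¬¬-excluded-middle; T?)
open import Relation.Nullary.Negation using (¬¬-map)

open import Algebra.Properties.Group ℚₚ.+-0-group using () renaming (⁻¹-involutive to neg-involutive)
open import Data.List.Extrema (DecTotalOrder.totalOrder ℚₚ.≤-decTotalOrder) using (v≤min⁺)

-- Integers inside the rationals, and rearranged rational inequalities.

ι : ℤ → ℚ
ι z = z / 1

-- Inherited from `toℚᵘ`, to which `fromℚᵘ` is inverse up to `≃`. As `ι z` computes to `fromℚᵘ` of a
-- fraction with denominator 1, this reduces sums under `ι` to an identity between integers.
fromℚᵘ-homo-+ : ∀ p q → fromℚᵘ (p ℚᵘ.+ q) ≡ fromℚᵘ p + fromℚᵘ q
fromℚᵘ-homo-+ p q = ℚₚ.toℚᵘ-injective (begin-equality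
  toℚᵘ (fromℚᵘ (p ℚᵘ.+ q))               ≃⟨ ℚₚ.toℚᵘ-fromℚᵘ (p ℚᵘ.+ q) ⟩
  p ℚᵘ.+ q                               ≃⟨ ℚᵘₚ.+-cong (ℚₚ.toℚᵘ-fromℚᵘ p) (ℚₚ.toℚᵘ-fromℚᵘ q) ⟨
  toℚᵘ (fromℚᵘ p) ℚᵘ.+ toℚᵘ (fromℚᵘ q)   ≃⟨ ℚₚ.toℚᵘ-homo-+ (fromℚᵘ p) (fromℚᵘ q) ⟨
  toℚᵘ (fromℚᵘ p + fromℚᵘ q)             ∎)
  where open ℚᵘₚ.≤-Reasoning

fromℚᵘ-homo-* : ∀ p q → fromℚᵘ (p ℚᵘ.* q) ≡ fromℚᵘ p * fromℚᵘ q
fromℚᵘ-homo-* p q = ℚₚ.toℚᵘ-injective (begin-equality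
  toℚᵘ (fromℚᵘ (p ℚᵘ.* q))               ≃⟨ ℚₚ.toℚᵘ-fromℚᵘ (p ℚᵘ.* q) ⟩
  p ℚᵘ.* q                               ≃⟨ ℚᵘₚ.*-cong (ℚₚ.toℚᵘ-fromℚᵘ p) (ℚₚ.toℚᵘ-fromℚᵘ q) ⟨
  toℚᵘ (fromℚᵘ p) ℚᵘ.* toℚᵘ (fromℚᵘ q)   ≃⟨ ℚₚ.toℚᵘ-homo-* (fromℚᵘ p) (fromℚᵘ q) ⟨
  toℚᵘ (fromℚᵘ p * fromℚᵘ q)             ∎)
  where open ℚᵘₚ.≤-Reasoning

ι-homo-+ : ∀ a b → ι (a ℤ.+ b) ≡ ι a + ι b
ι-homo-+ a b = trans
  (ℚₚ.fromℚᵘ-cong {ℚᵘ.mkℚᵘ (a ℤ.+ b) 0} {ℚᵘ.mkℚᵘ a 0 ℚᵘ.+ ℚᵘ.mkℚᵘ b 0}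
    (ℚᵘ.*≡* (cong (ℤ._* + 1) (sym (cong₂ ℤ._+_ (ℤₚ.*-identityʳ a) (ℤₚ.*-identityʳ b))))))
  (fromℚᵘ-homo-+ (ℚᵘ.mkℚᵘ a 0) (ℚᵘ.mkℚᵘ b 0))

ι-homo-* : ∀ a b → ι (a ℤ.* b) ≡ ι a * ι b
ι-homo-* a b = fromℚᵘ-homo-* (ℚᵘ.mkℚᵘ a 0) (ℚᵘ.mkℚᵘ b 0)

ι-homo‿- : ∀ a → ι (ℤ.- a) ≡ - ι a
ι-homo‿- (+ 0)     = refl
ι-homo‿- +[1+ n ]  = refl
-- `_/_` sends a negative numerator to the negation of its positive counterpart, so the right side
-- is a double negation.
ι-homo‿- -[1+ n ]  = sym (neg-involutive (ι +[1+ n ]))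

ι-mono-< : ∀ {a b} → a ℤ.< b → ι a < ι b
ι-mono-< {a} {b} a<b = ℚₚ.toℚᵘ-cancel-< (begin-strict
  toℚᵘ (ι a)     ≃⟨ ℚₚ.toℚᵘ-fromℚᵘ (ℚᵘ.mkℚᵘ a 0) ⟩
  ℚᵘ.mkℚᵘ a 0    <⟨ ℚᵘ.*<* (subst₂ ℤ._<_ (sym (ℤₚ.*-identityʳ a)) (sym (ℤₚ.*-identityʳ b)) a<b) ⟩
  ℚᵘ.mkℚᵘ b 0    ≃⟨ ℚₚ.toℚᵘ-fromℚᵘ (ℚᵘ.mkℚᵘ b 0) ⟨
  toℚᵘ (ι b)     ∎)
  where open ℚᵘₚ.≤-Reasoning

ι-positive : ∀ {a} → a ℤ.> + 0 → ℚ.Positive (ι a)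
ι-positive a>0 = ℚ.positive (ι-mono-< a>0)

ι*1/≡1 : ∀ k .{{_ : ℕ.NonZero k}} → ι (+ k) * (+ 1 / k) ≡ 1ℚ
ι*1/≡1 k@(suc k-1) = trans
  (sym (fromℚᵘ-homo-* (ℚᵘ.mkℚᵘ (+ k) 0) (ℚᵘ.mkℚᵘ (+ 1) k-1)))
  (ℚₚ.fromℚᵘ-cong {ℚᵘ.mkℚᵘ (+ k) 0 ℚᵘ.* ℚᵘ.mkℚᵘ (+ 1) k-1} {ℚᵘ.1ℚᵘ}
    (ℚᵘ.*≡* (trans (ℤₚ.*-identityʳ _) (trans (ℤₚ.*-comm (+ k) (+ 1))
      (cong (λ m → + 1 ℤ.* + m) (sym (ℕₚ.*-identityˡ k)))))))

neg-cancel-≤ : ∀ {p q} → - p ≤ - q → q ≤ p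
neg-cancel-≤ {p} {q} h = subst₂ _≤_ (neg-involutive q) (neg-involutive p) (ℚₚ.neg-antimono-≤ h)

q≤p⇒0≤p-q : ∀ {p q} → q ≤ p → 0ℚ ≤ p - q
q≤p⇒0≤p-q {p} {q} h = subst (_≤ p - q) (ℚₚ.+-inverseʳ q) (ℚₚ.+-monoˡ-≤ (- q) h)

p-q≤0⇒p≤q : ∀ {p q} → p - q ≤ 0ℚ → p ≤ q
p-q≤0⇒p≤q {p} {q} h = subst₂ _≤_
  (solve 2 (λ p q → p :- q :+ q := p) refl p q) (ℚₚ.+-identityˡ q) (ℚₚ.+-monoˡ-≤ q h)

-- Linear expressions under an arbitrary valuation of terms.

module _ {X : Set} (f : X → ℚ) where

  -- By definition `⟦ e ⟧ᵉ w` is the instance with `f` interpreting terms at `w`, so each law below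
  -- applies in every model without conversion.
  Σ : List (ℤ × X) → ℚ
  Σ = foldr (λ (a , t) q → ι a * f t + q) 0ℚ

  Σ-single : ∀ t → Σ ((+ 1 , t) ∷ []) ≡ f t
  Σ-single t = trans (ℚₚ.+-identityʳ _) (ℚₚ.*-identityˡ (f t))

  Σ-++ : ∀ xs ys → Σ (xs ++ ys) ≡ Σ xs + Σ ys
  Σ-++ []             ys = sym (ℚₚ.+-identityˡ _)
  Σ-++ ((a , t) ∷ xs) ys =
    trans (cong (λ q → ι a * f t + q) (Σ-++ xs ys)) (sym (ℚₚ.+-assoc (ι a * f t) (Σ xs) (Σ ys)))

  Σ-scale : ∀ d xs → Σ (map (λ (a , t) → d ℤ.* a , t) xs) ≡ ι d * Σ xs
  Σ-scale d []             = sym (ℚₚ.*-zeroʳ (ι d))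
  Σ-scale d ((a , t) ∷ xs) = trans
    (cong₂ _+_ (cong (_* f t) (ι-homo-* d a)) (Σ-scale d xs))
    (solve 4 (λ d a t s → d :* a :* t :+ d :* s := d :* (a :* t :+ s)) refl (ι d) (ι a) (f t) (Σ xs))

  Σ-neg : ∀ xs → Σ (map (λ (a , t) → ℤ.- a , t) xs) ≡ - Σ xs
  Σ-neg []             = refl
  Σ-neg ((a , t) ∷ xs) = trans
    (cong₂ _+_ (cong (_* f t) (ι-homo‿- a)) (Σ-neg xs))
    (solve 3 (λ a t s → :- a :* t :+ :- s := :- (a :* t :+ s)) refl (ι a) (f t) (Σ xs))

  Σ-add : ∀ (xs : List (ℤ × ℤ × X)) →
          Σ (map (λ (a , a′ , t) → a ℤ.+ a′ , t) xs) ≡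
          Σ (map (λ (a , a′ , t) → a , t) xs) + Σ (map (λ (a , a′ , t) → a′ , t) xs)
  Σ-add []                  = refl
  Σ-add ((a , a′ , t) ∷ xs) = trans
    (cong₂ _+_ (cong (_* f t) (ι-homo-+ a a′)) (Σ-add xs))
    (solve 5 (λ a a′ t s s′ → (a :+ a′) :* t :+ (s :+ s′) := a :* t :+ s :+ (a′ :* t :+ s′)) refl
      (ι a) (ι a′) (f t) _ _)

  Σ-↭ : ∀ {xs ys} → xs ↭ ys → Σ xs ≡ Σ ys
  Σ-↭ ↭.refl                = refl
  Σ-↭ (↭.prep (a , t) p)    = cong (λ q → ι a * f t + q) (Σ-↭ p)
  Σ-↭ (↭.swap {ys = ys} (a , t) (b , u) p) = trans
    (cong (λ s → ι a * f t + (ι b * f u + s)) (Σ-↭ p))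
    (solve 3 (λ x y s → x :+ (y :+ s) := y :+ (x :+ s)) refl (ι a * f t) (ι b * f u) (Σ ys))
  Σ-↭ (↭.trans p q)         = trans (Σ-↭ p) (Σ-↭ q)

  -- Made for `charge`: `c` replaces a summand by a short expression, `f` is the valuation before
  -- the update, `g` the one after it, and `d` the size of the group. The `foldr` is `Σ` for `g`.
  Σ-concat : ∀ (g : X → ℚ) d (c : ℤ × X → List⁺ (ℤ × X)) →
             (∀ a t → Σ (toList (c (a , t))) ≡ d * (ι a * g t)) →
             ∀ xs → Σ (concat (map toList (map c xs))) ≡
                    d * foldr (λ (a , t) q → ι a * g t + q) 0ℚ xs
  Σ-concat g d c eq []             = sym (ℚₚ.*-zeroʳ d)
  Σ-concat g d c eq ((a , t) ∷ xs) = trans (Σ-++ (toList (c (a , t))) _)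
    (trans (cong₂ _+_ (eq a t) (Σ-concat g d c eq xs)) (sym (ℚₚ.*-distribˡ-+ d _ _)))

-- Classical connectives and valuations under double negation.

-- The object-language φ ⇒ ψ unfolds to ¬ (φ × ¬ ψ).
module _ {P Q : Set} where

  ⇒⁺ : (P → Q) → ¬ (P × ¬ Q)
  ⇒⁺ f (p , ¬q) = ¬q (f p)

  ⇒⁻ : (¬ ¬ Q → Q) → ¬ (P × ¬ Q) → P → Q
  ⇒⁻ stable h p = stable λ ¬q → h (p , ¬q)

  ⇔⁺ : (P → Q) → (Q → P) → ¬ (P × ¬ Q) × ¬ (Q × ¬ P)
  ⇔⁺ f g = (λ (p , ¬q) → ¬q (f p)) , (λ (q , ¬p) → ¬p (g q))

-- Each single case distinction is available under a double negation, and finitely many can be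
-- nested; doing so for all indices at once would require double-negation shift. Hence the bound.
¬¬-valuation : ∀ N (P : ℕ → Set) →
               ¬ ¬ (Σ[ v ∈ (ℕ → Bool) ] ∀ x → x ℕ.< N → P x ⇔ T (v x))
-- The value `true` is an arbitrary default: nothing is claimed from the bound onwards.
¬¬-valuation zero    P k = k ((λ _ → true) , λ _ ())
¬¬-valuation (suc N) P k = ¬¬-excluded-middle λ P0? → ¬¬-valuation N (P ∘ suc) λ (v , ok) →
  k ( (λ { zero → isYes P0? ; (suc x) → v x })
    , λ { zero    _         → mk⇔ fromWitness toWitness
        ; (suc x) (s≤s x<N) → ok x x<N })

module Soundness (Letter : Set) (p₀ : Letter) (n : ℕ) where
  open SPQ Letter p₀ n hiding (_⇔_)

  group-nonZero : (G : Group) → ℕ.NonZero ∣ value G ∣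
  group-nonZero (G , [ nonempty ]) = size-nonZero G nonempty

  stable : ∀ M w φ → ¬ ¬ (M , w ⊨ φ) → M , w ⊨ φ
  stable M w (atom (var p))    h = decidable-stable (T? _) h
  stable M w (atom (ineq e z)) h = decidable-stable (_ ℚₚ.≤? _) h
  stable M w (neg φ)           h = λ x → h λ ¬x → ¬x x
  stable M w (conj φ ψ)        h = stable M w φ (¬¬-map proj₁ h) , stable M w ψ (¬¬-map proj₂ h)
  stable M w (K i φ)           h = λ w′ r → stable M w′ φ (¬¬-map (λ f → f w′ r) h)
  stable M w (C G φ)           h = λ w′ r → stable M w′ φ (¬¬-map (λ f → f w′ r) h)
  stable M w ([? G ^ A ] φ)    h = λ b → stable _ _ φ (¬¬-map (λ f → f b) h)

  module _ (M : Model) (w : Model.W M) where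
    open Model M

    -- ⊨-inst asks for Booleans matching all σ x at once; for arbitrary σ these
    -- exist only up to double negation and for finitely many x.
    ⊨-inst-bounded : ∀ (σ : ℕ → Form) B →
      ∃[ N ] ∀ v → (∀ x → x ℕ.< N → (M , w ⊨ σ x) ⇔ T (v x)) →
             (M , w ⊨ inst σ B) ⇔ T (eval v B)
    ⊨-inst-bounded σ (atom x)   = suc x , λ v ok → ok x ℕₚ.≤-refl
    ⊨-inst-bounded σ (neg B)    =
      let N , ih = ⊨-inst-bounded σ B in N , λ v ok → negate (ih v ok)
      where
      negate : ∀ {P b} → P ⇔ T b → (¬ P) ⇔ T (not b)
      negate {b = true}  e = mk⇔ (λ ¬p → ¬p (from e _)) (λ ())
      negate {b = false} e = mk⇔ _ (λ _ → to e)
    ⊨-inst-bounded σ (conj B D) =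
      let N , ihB = ⊨-inst-bounded σ B
          L , ihD = ⊨-inst-bounded σ D
      in N ℕ.⊔ L , λ v ok →
        let b = ihB v λ x x<N → ok x (ℕₚ.<-≤-trans x<N (ℕₚ.m≤m⊔n N L))
            d = ihD v λ x x<L → ok x (ℕₚ.<-≤-trans x<L (ℕₚ.m≤n⊔m N L))
        in mk⇔ (λ (x , y) → from T-∧ (to b x , to d y))
               (λ t → let x , y = to (T-∧ {eval v B}) t in from b x , from d y)

    -- A Boolean valuation matching `σ` on the atoms of `B` exists under a double negation, which
    -- stability of truth removes.
    ⊨-tautology : ∀ σ B → Tautology B → M , w ⊨ inst σ B
    ⊨-tautology σ B taut =
      let N , iff = ⊨-inst-bounded σ B
      in stable M w (inst σ B) (¬¬-map (λ (v , ok) → from (iff v ok) (taut v))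
           (¬¬-valuation N λ x → M , w ⊨ σ x))

    ⊨⋀⁺ : ∀ {I : Set} (is : List I) {φ : I → Form} →
          (∀ i → i ∈ₗ is → M , w ⊨ φ i) → M , w ⊨ ⋀ is φ
    -- The empty conjunction is `⊤`, that is `p₀ ∨ ~ p₀`, whose truth unfolds to ¬ (¬ p × ¬ ¬ p).
    ⊨⋀⁺ []       h = λ (¬p , ¬¬p) → ¬¬p ¬p
    ⊨⋀⁺ (i ∷ is) h = h i (here refl) , ⊨⋀⁺ is (λ j j∈ → h j (there j∈))

    ⊨⋀⁻ : ∀ {I : Set} (is : List I) {φ : I → Form} →
          M , w ⊨ ⋀ is φ → ∀ i → i ∈ₗ is → M , w ⊨ φ i
    ⊨⋀⁻ (i ∷ is) (h , hs) i (here refl) = h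
    ⊨⋀⁻ (_ ∷ is) (h , hs) i (there i∈)  = ⊨⋀⁻ is hs i i∈

    ⊨E⁺ : ∀ G {φ} → (∀ i → i ∈ G → M , w ⊨ K i φ) → M , w ⊨ E G φ
    ⊨E⁺ G h = ⊨⋀⁺ (members G) λ i i∈ → h i (proj₂ (∈-filter⁻ (_∈? G) {xs = allFin n} i∈))

    ⊨E⁻ : ∀ G {φ} → M , w ⊨ E G φ → ∀ i → i ∈ G → M , w ⊨ K i φ
    ⊨E⁻ G h i i∈ = ⊨⋀⁻ (members G) h i (∈-filter⁺ (_∈? G) (∈-allFin i) i∈)

    holds-⋀⁺ : ∀ {I : Set} (is : List I) {φ : I → Static} →
               (∀ i → i ∈ₗ is → T (holds w (φ i))) → T (holds w (⋀ is φ))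
    holds-⋀⁺ []       h = ⊤-holds (V p₀ w)
      where
      -- Under the constant valuation `b`, the `⊤` of `PL` computes to the same Boolean as the `⊤`
      -- of `Static` when `p₀` has value `b`.
      ⊤-holds : ∀ b → T (eval (λ _ → b) (⊤ {{PL-language}}))
      ⊤-holds true  = _
      ⊤-holds false = _
    holds-⋀⁺ (i ∷ is) h = from T-∧ (h i (here refl) , holds-⋀⁺ is (λ j j∈ → h j (there j∈)))

    holds-⋁⁺ : ∀ {I : Set} {is : List I} {φ : I → Static} {i} →
               i ∈ₗ is → T (holds w (φ i)) → T (holds w (⋁ is φ))
    holds-⋁⁺ {φ = φ} {i} (here refl) h with holds w (φ i)
    ... | true = _
    holds-⋁⁺ {is = j ∷ is} {φ} (there i∈) h
      with holds w (φ j) | holds w (⋁ is φ) | holds-⋁⁺ {φ = φ} i∈ h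
    ... | true  | _    | _ = _
    ... | false | true | _ = _

    ⟦⊝⟧ : ∀ e f → ⟦ e ⊝ f ⟧ᵉ w ≡ ⟦ e ⟧ᵉ w - ⟦ f ⟧ᵉ w
    ⟦⊝⟧ e f = trans (Σ-++ (λ t → ⟦ t ⟧ᵗ w) (toList e) _)
                    (cong (λ q → ⟦ e ⟧ᵉ w + q) (Σ-neg (λ t → ⟦ t ⟧ᵗ w) (toList f)))

    ⊨≤ᶜ⁺ : ∀ e z → ⟦ e ⟧ᵉ w ≤ ι z → M , w ⊨ ⌈ e ≤ᶜ z ⌉
    ⊨≤ᶜ⁺ e z h = subst₂ _≤_ (sym (ι-homo‿- z)) (sym (Σ-neg (λ t → ⟦ t ⟧ᵗ w) (toList e)))
                   (ℚₚ.neg-antimono-≤ h)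

    ⊨≤ᶜ⁻ : ∀ e z → M , w ⊨ ⌈ e ≤ᶜ z ⌉ → ⟦ e ⟧ᵉ w ≤ ι z
    ⊨≤ᶜ⁻ e z h = neg-cancel-≤
      (subst₂ _≤_ (ι-homo‿- z) (Σ-neg (λ t → ⟦ t ⟧ᵗ w) (toList e)) h)

    ⟦1·⟧ : ∀ t → ⟦ + 1 · t ⟧ᵉ w ≡ ⟦ t ⟧ᵗ w
    ⟦1·⟧ = Σ-single (λ t → ⟦ t ⟧ᵗ w)

    ⊨=ᶜ⁺ : ∀ e z → ⟦ e ⟧ᵉ w ≡ ι z → M , w ⊨ ⌈ e =ᶜ z ⌉
    ⊨=ᶜ⁺ e z eq = ℚₚ.≤-reflexive (sym eq) , ⊨≤ᶜ⁺ e z (ℚₚ.≤-reflexive eq)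

    ⊨=ᵉ⁺ : ∀ e f → ⟦ e ⟧ᵉ w ≡ ⟦ f ⟧ᵉ w → M , w ⊨ ⌈ e =ᵉ f ⌉
    ⊨=ᵉ⁺ e f eq = ⊨=ᶜ⁺ (e ⊝ f) (+ 0)
      (trans (⟦⊝⟧ e f) (trans (cong (_- ⟦ f ⟧ᵉ w) eq) (ℚₚ.+-inverseʳ (⟦ f ⟧ᵉ w))))

    holds-cheapest : ∀ {A i j} → T (holds w (+ 1 · cost j A ≤ᵉ + 1 · cost i A)) →
                     Cost j w A ≤ Cost i w A
    holds-cheapest {A} {i} {j} h = p-q≤0⇒p≤q (subst (_≤ 0ℚ)
      (trans (⟦⊝⟧ (+ 1 · cost j A) (+ 1 · cost i A))
             (cong₂ _-_ (⟦1·⟧ (cost j A)) (⟦1·⟧ (cost i A))))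
      (⊨≤ᶜ⁻ (+ 1 · cost j A ⊝ + 1 · cost i A) (+ 0) (toWitness h)))

    -- The member `j` excludes the empty list, on which `minCost` has a dummy value that `v` might
    -- exceed.
    v≤minCost : ∀ {A v j} is → j ∈ₗ is → (∀ {i} → i ∈ₗ is → v ≤ Cost i w A) → v ≤ minCost w A is
    v≤minCost (i ∷ is) _ h = v≤min⁺ (h (here refl)) (All.map⁺ (All.tabulate (h ∘ there)))

    -- The cost of `j` is among those minimised and is a lower bound of them all. So the amount
    -- charged is the same for every cheapest agent.
    minCost-cheapest : ∀ G A {j} → j ∈ₗ members G → T (holds w (cheapest G A j)) →
                       minCost w A (members G) ≡ Cost j w A
    minCost-cheapest G A {j} j∈ h = ℚₚ.≤-antisym
      (minCost≤ M w A (members G) j∈)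
      (v≤minCost (members G) j∈ λ i∈ → holds-cheapest (⋀⁻ M w (members G) _ h i∈))

    -- Supplies the disjunct to be made true in `_≥ᶜ_^⟨_,_⟩`: the agent witnessing BCS, with the
    -- budget conditions dropped.
    BCS-cheapest : ∀ G A → T (holds w (BCS G A)) →
                   ∃[ j ] j ∈ₗ members G × T (holds w (cheapest G A j))
    BCS-cheapest G A h =
      let j , j∈ , hj = ⋁⁻ M w (members G) _ h
      in j , j∈ , holds-⋀⁺ (members G) λ i i∈ → proj₁ (to T-∧ (⋀⁻ M w (members G) _ hj i∈))

    -- Charging the cost of a question.

    module _ (G : Group) (A : PL) (h : T (holds w (BCS (value G) A))) where
      private
        M′ = update M G A (w , h)
        g = value G
        k = ι (+ ∣ g ∣)
        instance
          ∣g∣≢0 : ℕ.NonZero ∣ g ∣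
          ∣g∣≢0 = group-nonZero G

      -- Multiplying by `k` clears the fraction in an updated budget: `k` times the share is the
      -- cost of the cheapest `j`, which `chargeTerm` subtracts with the coefficient of that budget.
      -- `Σ-concat` adds up the terms.
      ⟦charge⟧ : ∀ {j} → j ∈ₗ members g → T (holds w (cheapest g A j)) →
                 ∀ e → ⟦ charge g A j e ⟧ᵉ w ≡ k * Model.⟦_⟧ᵉ M′ e (w , h)
      ⟦charge⟧ {j} j∈ hj e =
        Σ-concat (λ t → ⟦ t ⟧ᵗ w) (λ t → Model.⟦_⟧ᵗ M′ t (w , h)) k (chargeTerm g A j) term (toList e)
        where
        open ≡-Reasoning
        k*share : k * share G A w ≡ Cost j w A
        k*share = begin
          k * ((+ 1 / ∣ g ∣) * minCost w A (members g))  ≡⟨ ℚₚ.*-assoc k (+ 1 / ∣ g ∣) _ ⟨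
          k * (+ 1 / ∣ g ∣) * minCost w A (members g)
            ≡⟨ cong₂ _*_ (ι*1/≡1 ∣ g ∣) (minCost-cheapest g A j∈ hj) ⟩
          1ℚ * Cost j w A                                ≡⟨ ℚₚ.*-identityˡ _ ⟩
          Cost j w A                                     ∎

        unchanged : ∀ a c → ι (+ ∣ g ∣ ℤ.* a) * c + 0ℚ ≡ k * (ι a * c)
        unchanged a c = begin
          ι (+ ∣ g ∣ ℤ.* a) * c + 0ℚ   ≡⟨ ℚₚ.+-identityʳ _ ⟩
          ι (+ ∣ g ∣ ℤ.* a) * c        ≡⟨ cong (_* c) (ι-homo-* (+ ∣ g ∣) a) ⟩
          k * ι a * c                  ≡⟨ ℚₚ.*-assoc k (ι a) c ⟩
          k * (ι a * c)                ∎

        term : ∀ a t → Σ (λ t → ⟦ t ⟧ᵗ w) (toList (chargeTerm g A j (a , t))) ≡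
                       k * (ι a * Model.⟦_⟧ᵗ M′ t (w , h))
        term a (cost i B) = unchanged a (Cost i w B)
        -- Both `chargeTerm` and `Bdg′` branch on this test, so one case split reduces both sides.
        term a (budget i) with i ∈? g
        ... | no  _ = unchanged a (Bdg i w)
        ... | yes _ = begin
          ι (+ ∣ g ∣ ℤ.* a) * Bdg i w + (ι (ℤ.- a) * Cost j w A + 0ℚ)
            ≡⟨ cong₂ (λ x y → x * Bdg i w + (y * Cost j w A + 0ℚ)) (ι-homo-* (+ ∣ g ∣) a) (ι-homo‿- a) ⟩
          k * ι a * Bdg i w + (- ι a * Cost j w A + 0ℚ)
            ≡⟨ cong (λ c → k * ι a * Bdg i w + (- ι a * c + 0ℚ)) k*share ⟨
          k * ι a * Bdg i w + (- ι a * (k * share G A w) + 0ℚ)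
            ≡⟨ solve 4 (λ k a b s → k :* a :* b :+ (:- a :* (k :* s) :+ con 0ℚ) := k :* (a :* (b :- s)))
                 refl k (ι a) (Bdg i w) (share G A w) ⟩
          k * (ι a * (Bdg i w - share G A w)) ∎

      -- Both sides of the inequality are scaled by `k`, which is positive because the group is
      -- nonempty; such scaling preserves and reflects the order.
      ⊨charged : ∀ {j} → j ∈ₗ members g → T (holds w (cheapest g A j)) → ∀ e z →
                 (M′ , (w , h) ⊨ ⌈ e ≥ᶜ z ⌉) ⇔ (M , w ⊨ ⌈ charge g A j e ≥ᶜ (+ ∣ g ∣ ℤ.* z) ⌉)
      ⊨charged j∈ hj e z = mk⇔
        (λ le → subst₂ _≤_ (sym (ι-homo-* (+ ∣ g ∣) z)) (sym (⟦charge⟧ j∈ hj e))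
                  (ℚₚ.*-monoˡ-≤-nonNeg k {{ℚₚ.pos⇒nonNeg k}} le))
        (λ le → ℚₚ.*-cancelˡ-≤-pos k (subst₂ _≤_ (ι-homo-* (+ ∣ g ∣) z) (⟦charge⟧ j∈ hj e) le))
        where instance
        k>0 : ℚ.Positive k
        k>0 = ℚₚ.normalize-pos ∣ g ∣ 1

  ⊨≥^⁺ : ∀ M w G A e z → M , w ⊨ [? G ^ A ] ⌈ e ≥ᶜ z ⌉ →
         T (Model.holds M w (BCS (value G) A)) → M , w ⊨ ⌈ e ≥ᶜ z ^⟨ value G , A ⟩ ⌉
  ⊨≥^⁺ M w G A e z f h =
    let j , j∈ , hj = BCS-cheapest M w (value G) A h
    in from (⊨⌈⌉ M w (e ≥ᶜ z ^⟨ value G , A ⟩))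
         (holds-⋁⁺ M w j∈ (from T-∧ (hj , fromWitness (to (⊨charged M w G A h j∈ hj e z) (f h)))))

  ⊨≥^⁻ : ∀ M w G A e z → M , w ⊨ ⌈ e ≥ᶜ z ^⟨ value G , A ⟩ ⌉ → M , w ⊨ [? G ^ A ] ⌈ e ≥ᶜ z ⌉
  ⊨≥^⁻ M w G A e z x h =
    let j , j∈ , hj = ⋁⁻ M w (members (value G)) _ (to (⊨⌈⌉ M w (e ≥ᶜ z ^⟨ value G , A ⟩)) x)
        cheap , le  = to (T-∧ {Model.holds M w (cheapest (value G) A j)}) hj
    in from (⊨charged M w G A h j∈ cheap e z) (toWitness le)

  -- Worlds that agree on the question.

  ⊨pl-agree : ∀ M A {x y} → M , x ⊨ pl A → M , y ⊨ pl A → Model.holdsPL M x A ≡ Model.holdsPL M y A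
  ⊨pl-agree M A {x} {y} p q =
    trans (to T-≡ (to (⊨pl M x A) p)) (sym (to T-≡ (to (⊨pl M y A) q)))

  -- `A` has a Boolean value at `x`, so `A` or its negation holds there, and by agreement also at
  -- `y`. The continuation takes whichever it is as `A′`, so that users argue once for both cases.
  both⁻ : ∀ M A (φ : Form → Form) {x y} {Q : Set} → Model.holdsPL M x A ≡ Model.holdsPL M y A →
          M , x ⊨ both A φ →
          (∀ A′ → M , x ⊨ φ A′ → M , x ⊨ A′ → M , y ⊨ A′ → Q) → Q
  both⁻ M A φ {x} {y} agree (if⊤ , if⊥) use with Model.holdsPL M x A in eq
  ... | true  = use (pl A) if⊤ (from (⊨pl M x A) (from T-≡ eq)) (from (⊨pl M y A) (from T-≡ (sym agree)))
  ... | false = use (pl (~ A)) if⊥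
    (from (⊨pl M x (~ A)) (from T-≡ (cong not eq)))
    (from (⊨pl M y (~ A)) (from T-≡ (cong not (sym agree))))

  -- The axioms and rules.

  sound : ∀ {φ} → ⊢ φ → ∀ M w → M , w ⊨ φ
  sound (Taut B taut σ) M w = ⊨-tautology M w σ B taut
  sound (I1 {e} {t} {c}) M w = ⇔⁺ (subst (ι c ≤_) (sym eq)) (subst (ι c ≤_) eq)
    where
    open Model M
    eq : ⟦ e List⁺.⁺∷ʳ (+ 0 , t) ⟧ᵉ w ≡ ⟦ e ⟧ᵉ w
    eq = trans (Σ-++ (λ t → ⟦ t ⟧ᵗ w) (toList e) ((+ 0 , t) ∷ []))
      (trans (cong (λ q → ⟦ e ⟧ᵉ w + (q + 0ℚ)) (ℚₚ.*-zeroˡ (⟦ t ⟧ᵗ w))) (ℚₚ.+-identityʳ _))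
  sound (I2 {c = c} p) M w = ⇒⁺ (subst (ι c ≤_) (Σ-↭ (λ t → Model.⟦_⟧ᵗ M t w) p))
  sound (I3 l {c} {c′}) M w = ⇒⁺ λ (x , y) →
    subst₂ _≤_ (sym (ι-homo-+ c c′)) (sym (Σ-add (λ t → Model.⟦_⟧ᵗ M t w) (toList l))) (ℚₚ.+-mono-≤ x y)
  sound (I4 {e} {c} {d} d>0) M w = ⇔⁺
    (λ x → subst₂ _≤_ (sym (ι-homo-* d c)) (sym eq) (ℚₚ.*-monoˡ-≤-nonNeg (ι d) x))
    (λ x → ℚₚ.*-cancelˡ-≤-pos (ι d) (subst₂ _≤_ (ι-homo-* d c) eq x))
    where
    eq = Σ-scale (λ t → Model.⟦_⟧ᵗ M t w) d (toList e)
    instance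
      pos = ι-positive d>0
      nonNeg = ℚₚ.pos⇒nonNeg (ι d)
  sound (I5 {e} {c}) M w (≱ , ≰) with ℚₚ.≤-total (ι c) (Model.⟦_⟧ᵉ M e w)
  ... | inj₁ c≤e = ≱ c≤e
  ... | inj₂ e≤c = ≰ (⊨≤ᶜ⁺ M w e c e≤c)
  sound (I6 {e} {c} {d} c>d) M w = ⇒⁺ λ c≤e e≤d →
    ℚₚ.<-irrefl refl (ℚₚ.<-≤-trans (ι-mono-< c>d) (ℚₚ.≤-trans c≤e (⊨≤ᶜ⁻ M w e d e≤d)))

  sound (axK {ψ = ψ}) M w = ⇒⁺ λ f → ⇒⁺ λ g w′ r → ⇒⁻ (stable M w′ ψ) (f w′ r) (g w′ r)
  sound (axT {i}) M w = ⇒⁺ λ f → f w (IsEquivalence.refl (Model.∼-equiv M i))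
  sound (ax4 {i}) M w = ⇒⁺ λ f x r y s → f y (IsEquivalence.trans (Model.∼-equiv M i) r s)
  sound (ax5 {i}) M w = ⇒⁺ λ ¬f x r f → ¬f λ y s →
    let module ∼ = IsEquivalence (Model.∼-equiv M i) in f y (∼.trans (∼.sym r) s)
  sound (axC {G}) M w = ⇒⁺ λ f → ⊨E⁺ M w G λ i i∈ x r →
    -- One step is already a path to `x`; prefixed to a path from `x`, it gives a path from `w`.
    f x [ i , i∈ , r ] , λ y s → f y ((i , i∈ , r) ∷ s)

  sound (B⁺ {i}) M w =
    subst (0ℚ ≤_) (sym (⟦1·⟧ M w (budget i))) (Model.Bdg-nonneg M i w)
  sound (c⁺ {i} {A}) M w =
    subst (0ℚ ≤_) (sym (⟦1·⟧ M w (cost i A))) (Model.Cost-nonneg M i w A)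
  sound (c⊤ {i}) M w =
    ⊨=ᶜ⁺ M w (+ 1 · cost i ⊤) (+ 0) (trans (⟦1·⟧ M w (cost i ⊤)) (Model.Cost-⊤ M i w))
  sound (c≈ {i} {A} {B} A≈B) M w = ⊨=ᵉ⁺ M w (+ 1 · cost i A) (+ 1 · cost i B)
    (trans (⟦1·⟧ M w (cost i A)) (trans (Model.Cost-≈ M i w A≈B) (sym (⟦1·⟧ M w (cost i B)))))

  sound (rp {G} {A} {p}) M w = ⇔⁺
    (λ f → ⇒⁺ λ b → f (to (⊨⌈⌉ M w (BCS (value G) A)) b))
    (λ g h → ⇒⁻ (stable M w (letter p)) g (from (⊨⌈⌉ M w (BCS (value G) A)) h))
  sound (r≥ {G} {A} {e} {z}) M w = ⇔⁺
    (λ f → ⇒⁺ λ b → ⊨≥^⁺ M w G A e z f (to (⊨⌈⌉ M w (BCS (value G) A)) b))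
    (λ g h → ⊨≥^⁻ M w G A e z
      (⇒⁻ (stable M w ⌈ e ≥ᶜ z ^⟨ value G , A ⟩ ⌉) g (from (⊨⌈⌉ M w (BCS (value G) A)) h)) h)
  sound (r¬ {G} {A} {φ}) M w = ⇔⁺
    (λ f → ⇒⁺ λ b x → let h = to (⊨⌈⌉ M w (BCS (value G) A)) b in f h (x h))
    -- A world of the update contains a proof that BCS holds. Truth at `h` must be carried over to
    -- every such proof `h′` to refute the negated update formula.
    (λ g h x → g ( from (⊨⌈⌉ M w (BCS (value G) A)) h
                 , λ ¬f → ¬f λ h′ →
                     subst (λ h → update M G A (w , h) , (w , h) ⊨ φ) (T-irrelevant h h′) x))
  sound r∧ M w = ⇔⁺
    (λ f → (λ h → proj₁ (f h)) , (λ h → proj₂ (f h)))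
    (λ (f , g) h → f h , g h)
  sound (rK₁ {G} {A} {j} {φ} j∉G) M w = ⇔⁺
    (λ f → ⇒⁺ λ b x r h′ →
      f (to (⊨⌈⌉ M w (BCS (value G) A)) b) (x , h′) (r , λ j∈G → contradiction j∈G j∉G))
    (λ g h (x , h′) (r , _) →
      ⇒⁻ (stable M w (K j ([? G ^ A ] φ))) g (from (⊨⌈⌉ M w (BCS (value G) A)) h) x r h′)
  sound (rK₂ {G} {A} {i} {φ} i∈G) M w = ⇔⁺
    (λ f → ⇒⁺ λ b →
      let h = to (⊨⌈⌉ M w (BCS (value G) A)) b
          case : ∀ A′ → (∀ {x} → M , w ⊨ A′ → M , x ⊨ A′ → Model.holdsPL M w A ≡ Model.holdsPL M x A) →
                 M , w ⊨ A′ ⇒ K i (A′ ⇒ [? G ^ A ] φ)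
          case A′ agree = ⇒⁺ λ a x r → ⇒⁺ λ a′ h′ → f h (x , h′) (r , λ _ → agree a a′)
      in case (pl A) (⊨pl-agree M A)
       , case (pl (~ A)) (λ a a′ → not-injective (⊨pl-agree M (~ A) a a′)))
    (λ g h (x , h′) (r , agree) →
      both⁻ M A branch (agree i∈G)
        (⇒⁻ (stable M w (both A branch)) g (from (⊨⌈⌉ M w (BCS (value G) A)) h))
        λ A′ k a a′ → ⇒⁻ (stable M x ([? G ^ A ] φ))
          (⇒⁻ (stable M w (K i (A′ ⇒ [? G ^ A ] φ))) k a x r) a′ h′)
    where
    branch : Form → Form
    branch A′ = A′ ⇒ K i (A′ ⇒ [? G ^ A ] φ)

  sound (MP {ψ = ψ} d d′) M w = ⇒⁻ (stable M w ψ) (sound d′ M w) (sound d M w)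
  sound (Nec d) M w = λ x _ → sound d M x
  sound (RC1 {G} {φ} {ψ} d) M w = ⇒⁺ λ x y → along w y x
    where
    step : ∀ x → M , x ⊨ φ → ∀ i y → i ∈ G → Model._∼[_]_ M x i y → M , y ⊨ φ ∧ ψ
    step x hx i y i∈ r =
      ⊨E⁻ M x G (⇒⁻ (stable M x (E G (φ ∧ ψ))) (sound d M x) hx) i i∈ y r

    along : ∀ x y → M , x ⊨ φ → Model._∼⟨_⟩_ M x G y → M , y ⊨ ψ
    -- Paths have at least one step: the last yields `ψ`, and the earlier ones only hand on `φ`.
    along x y hx [ i , i∈ , r ] = proj₂ (step x hx i y i∈ r)
    along x y hx (_∷_ {y = u} (i , i∈ , r) s) =
      along u y (proj₁ (step x hx i u i∈ r)) s
  sound (Rep {G} {A} {φ} {ψ} d) M w = ⇔⁺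
    -- The premise is used in the updated model, which is why the induction covers all models.
    (λ f h → ⇒⁻ (stable _ _ ψ) (proj₁ (sound d _ _)) (f h))
    (λ f h → ⇒⁻ (stable _ _ φ) (proj₂ (sound d _ _)) (f h))
  sound (RC2 {G} {A} {H} {χ} {ψ} d d′) M w = ⇒⁺ λ x h (y , h′) → along (w , h) (w , h) (y , h′) x
    where
    -- The world passed to `update` is irrelevant, so `M′ x₀` and `M′ y` are definitionally equal. A
    -- path in the model built from `(w , h)` can therefore end in truth of `ψ` in the model built
    -- from its endpoint, as the first premise gives it.
    M′ : .(W′ M G A) → Model
    M′ = update M G A

    branch : Form → Form
    branch A′ = A′ ⇒ E (H ∩ value G) (A′ ⇒ χ)

    conclusion : Form
    conclusion = both A branch ∧ E (H ─ value G) χ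

    step : ∀ (x₀ x : W′ M G A) i y → i ∈ H → M , proj₁ x ⊨ χ →
           Model._∼[_]_ (M′ x₀) x i y → M , proj₁ y ⊨ χ
    step x₀ (x , h) i (y , _) i∈H hx (r , agree)
      with ⇒⁻ (stable M x conclusion) (sound d′ M x) (hx , from (⊨⌈⌉ M x (BCS (value G) A)) h)
         | i ∈? value G
    ... | asking , _ | yes i∈G = both⁻ M A branch (agree i∈G) asking λ A′ k a a′ →
      ⇒⁻ (stable M y χ)
        (⊨E⁻ M x (H ∩ value G) (⇒⁻ (stable M x (E (H ∩ value G) (A′ ⇒ χ))) k a)
           i (x∈p∩q⁺ (i∈H , i∈G)) y r) a′
    ... | _ , others | no  i∉G = ⊨E⁻ M x (H ─ value G) others i (x∈p∧x∉q⇒x∈p─q i∈H i∉G) y r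

    end : ∀ (y : W′ M G A) → M , proj₁ y ⊨ χ → M′ y , y ⊨ ψ
    end (y , h) hy = ⇒⁻ (stable M y ([? G ^ A ] ψ)) (sound d M y) hy h

    along : ∀ x₀ (x y : W′ M G A) → M , proj₁ x ⊨ χ → Model._∼⟨_⟩_ (M′ x₀) x H y → M′ y , y ⊨ ψ
    along x₀ x y hx [ i , i∈ , r ] = end y (step x₀ x i y i∈ hx r)
    along x₀ x y hx (_∷_ {y = u} (i , i∈ , r) s) =
      along x₀ u y (step x₀ x i u i∈ hx r) s

theorem3p1 : (Letter : Set) → Letter ↣ ℕ → (p₀ : Letter) (n : ℕ) →
    let open SPQ Letter p₀ n in
    (φ : Form) → ⊢ φ → (M : Model) (w : Model.W M) → M , w ⊨ φ
theorem3p1 Letter _ p₀ n φ d M w = Soundness.sound Letter p₀ n d M w
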